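{- Let $n\ge 6$ be an integer and let $\Delta_n$ be the graph defined in the context. Then the independent location number (independent metric dimension) of $\Delta_n$ is $3$, i.e. the minimum cardinality of a resolving set of $\Delta_n$ that is an independent set of vertices equals $3$.
   Context: All indices are taken modulo $n$. The heptagonal circular ladder $\Gamma_n$ is the graph with vertex set $\{p_t,q_t,r_t,s_t : 1\le t\le n\}$ and edge set $\{p_tp_{t+1},\ p_tq_t,\ q_tr_t,\ r_ts_t,\ s_tr_{t+1} : 1\le t\le n\}$. The graph $\Delta_n$ has the same vertex set as $\Gamma_n$ and edge set $E(\Gamma_n)\cup\{r_tq_{t+1}:1\le t\le n\}$. For a connected graph $G$ with distance $d$, a set $Y\subseteq V(G)$ is a resolving set if for every two distinct vertices $u,v$ there is $y\in Y$ with $d(y,u)\ne d(y,v)$. An independent resolving set is a resolving set no two of whose vertices are adjacent; the independent location number is the minimum cardinality of an independent resolving set. -}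

module Defs where

open import Data.Nat using (ℕ; zero; suc; _+_; _≤_; NonZero)
open import Data.Nat.DivMod using (_mod_)
open import Data.Fin using (Fin; toℕ)
open import Data.List using (List)
open import Data.List.Membership.Propositional using (_∈_)
open import Data.Product using (Σ; ∃; _×_; _,_)
open import Data.Sum using (_⊎_)
open import Relation.Binary.PropositionalEquality using (_≡_; _≢_)
open import Relation.Nullary using (¬_)

module _ (n : ℕ) .{{_ : NonZero n}} where

  -- indices t ∈ {0,…,n-1} (the paper's 1..n), taken modulo n
  nxt : Fin n → Fin n
  nxt t = (toℕ t + 1) mod n

  data V : Set where
    p q r s : Fin n → V

  -- edges of Δ_n (one orientation each): E(Γ_n) ∪ {r_t q_{t+1}}
  data Edge : V → V → Set where
    pp : ∀ t → Edge (p t) (p (nxt t))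
    pq : ∀ t → Edge (p t) (q t)
    qr : ∀ t → Edge (q t) (r t)
    rs : ∀ t → Edge (r t) (s t)
    sr : ∀ t → Edge (s t) (r (nxt t))
    rq : ∀ t → Edge (r t) (q (nxt t))

  Adj : V → V → Set
  Adj u v = Edge u v ⊎ Edge v u

  data Walk : V → V → ℕ → Set where
    [] : ∀ {u} → Walk u u zero
    _∷_ : ∀ {u w v k} → Adj u w → Walk w v k → Walk u v (suc k)

  Dist : V → V → ℕ → Set
  Dist u v k = Walk u v k × (∀ m → Walk u v m → k ≤ m)

  Resolving : List V → Set
  Resolving Y = ∀ u v → u ≢ v →
    Σ V λ y → y ∈ Y × Σ ℕ λ k → Σ ℕ λ k' → Dist y u k × Dist y v k' × k ≢ k'

  Independent : List V → Set
  Independent Y = ∀ u v → u ∈ Y → v ∈ Y → ¬ Adj u v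

{-# OPTIONS --safe #-}

-- In the infinite ladder the distance from X_0 to Y_k depends only on the kinds X, Y ∈ {p,q,r,s}
-- and k, and grows by 1 with k from k = 4 on; in Δ_n the distance is the smaller of the two
-- values given by the two arcs. So statements about distances in Δ_n that concern
-- boundedly many positions next to the landmarks reduce to finitely many cases: lengthening an
-- arc either changes no distance (the other arc is shorter) or shifts it by the added length.
--
-- Given two landmarks, at distance j along the shorter arc, one of twelve pairs of vertices
-- next to one of the landmarks is equidistant from both. Conversely, with m = ⌊n/2⌋, the
-- independent set {p_0, p_m, r_0} resolves Δ_n: the sum of the distances to p_0 and p_m, and
-- the difference of those to r_0 and p_0, determine the kind and the side of a vertex,
-- except near the landmarks where finitely many cases remain; the distance to p_0 then gives
-- its position.

module Submission where

open import Defs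
open import Data.Bool using (if_then_else_; _∧_)
open import Data.Fin using (Fin; toℕ)
open import Data.Fin.Properties using (toℕ<n; toℕ-fromℕ<; toℕ-injective; fromℕ<-cong)
open import Data.List using (List; []; _∷_; length; concatMap; upTo)
open import Data.List.Membership.Propositional using (_∈_)
open import Data.List.Relation.Unary.All using ([]; _∷_)
open import Data.List.Relation.Unary.AllPairs using ([]; _∷_)
open import Data.List.Relation.Unary.Any using (Any; here; there; any?; satisfied)
open import Data.List.Relation.Unary.Unique.Propositional using (Unique)
open import Data.Maybe using (Maybe; just; nothing)
import Data.Maybe.Properties as Maybe
open import Data.Nat
open import Data.Nat.DivMod
open import Data.Nat.Properties
open import Data.Nat.Solver using (module +-*-Solver)
open import Data.Product using (Σ; ∃; _×_; _,_; proj₁; proj₂; uncurry; map₂)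
import Data.Product.Properties as Product
open import Data.Sum using (_⊎_; inj₁; inj₂; swap)
open import Function using (_∘_)
open import Relation.Binary.PropositionalEquality
open import Relation.Nullary using (Dec; yes; no; ¬_; contradiction)
open import Relation.Nullary.Decidable using (map′; from-yes; _×-dec_; _⊎-dec_; _→-dec_; ¬?)
open +-*-Solver using (solve; con; _:=_; _:+_; _:*_)

-- Vertex kinds, edge families and finite quantification over them.

data Kind : Set where
  P Q R S : Kind

infix 4 _≟ᴷ_

_≟ᴷ_ : (X Y : Kind) → Dec (X ≡ Y)
P ≟ᴷ P = yes refl
P ≟ᴷ Q = no λ ()
P ≟ᴷ R = no λ ()
P ≟ᴷ S = no λ ()
Q ≟ᴷ P = no λ ()
Q ≟ᴷ Q = yes refl
Q ≟ᴷ R = no λ ()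
Q ≟ᴷ S = no λ ()
R ≟ᴷ P = no λ ()
R ≟ᴷ Q = no λ ()
R ≟ᴷ R = yes refl
R ≟ᴷ S = no λ ()
S ≟ᴷ P = no λ ()
S ≟ᴷ Q = no λ ()
S ≟ᴷ R = no λ ()
S ≟ᴷ S = yes refl

allKind? : {A : Kind → Set} → (∀ X → Dec (A X)) → Dec (∀ X → A X)
allKind? A? = map′
  (λ { (a , b , c , d) P → a ; (a , b , c , d) Q → b ; (a , b , c , d) R → c ; (a , b , c , d) S → d })
  (λ f → f P , f Q , f R , f S)
  (A? P ×-dec A? Q ×-dec A? R ×-dec A? S)

-- The six edge families: l joins (src l)_t to (tgt l)_{t + δ l}.
data Link : Set where
  PP PQ QR RS SR RQ : Link

src tgt : Link → Kind
src PP = P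
src PQ = P
src QR = Q
src RS = R
src SR = S
src RQ = R
tgt PP = P
tgt PQ = Q
tgt QR = R
tgt RS = S
tgt SR = R
tgt RQ = Q

δ : Link → ℕ
δ PP = 1
δ PQ = 0
δ QR = 0
δ RS = 0
δ SR = 1
δ RQ = 1

allLink? : {A : Link → Set} → (∀ l → Dec (A l)) → Dec (∀ l → A l)
allLink? A? = map′
  (λ { (a , b , c , d , e , f) → λ { PP → a ; PQ → b ; QR → c ; RS → d ; SR → e ; RQ → f } })
  (λ f → f PP , f PQ , f QR , f RS , f SR , f RQ)
  (A? PP ×-dec A? PQ ×-dec A? QR ×-dec A? RS ×-dec A? SR ×-dec A? RQ)

-- Distances in the infinite ladder.

-- A table lists the first values of a function that grows by 1 from its last listed value on.
look : List ℕ → ℕ → ℕ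
look []           k       = k
look (c ∷ [])     k       = c + k
look (c ∷ d ∷ cs) zero    = c
look (c ∷ d ∷ cs) (suc k) = look (d ∷ cs) k

look-shift : ∀ cs i k → length cs ≤ suc i → look cs (i + k) ≡ look cs i + k
look-shift []           i       k _         = refl
look-shift (c ∷ [])     i       k _         = sym (+-assoc c i k)
look-shift (c ∷ d ∷ cs) (suc i) k (s≤s len) = look-shift (d ∷ cs) i k len

-- Distances from X₀ to Y₀, Y₁, Y₂, … in the infinite ladder, where indices are integers.
table : Kind → Kind → List ℕ
table P P = 0 ∷ []
table P Q = 1 ∷ []
table P R = 2 ∷ []
table P S = 3 ∷ []
table Q P = 1 ∷ []
table Q Q = 0 ∷ 2 ∷ 4 ∷ []
table Q R = 1 ∷ 3 ∷ 5 ∷ []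
table Q S = 2 ∷ 4 ∷ 6 ∷ []
table R P = 2 ∷ 2 ∷ []
table R Q = 1 ∷ 1 ∷ 3 ∷ 5 ∷ []
table R R = 0 ∷ 2 ∷ 4 ∷ 6 ∷ []
table R S = 1 ∷ 3 ∷ 5 ∷ 7 ∷ []
table S P = 3 ∷ 3 ∷ 3 ∷ []
table S Q = 2 ∷ 2 ∷ 2 ∷ 4 ∷ 6 ∷ []
table S R = 1 ∷ 1 ∷ 3 ∷ 5 ∷ 7 ∷ []
table S S = 0 ∷ 2 ∷ 4 ∷ 6 ∷ 8 ∷ []

D : Kind → Kind → ℕ → ℕ
D X Y = look (table X Y)

-- Distances in Δ_n: k and l = n − k are the lengths of the two arcs from X_x to Y_{x+k}.
G : Kind → Kind → ℕ → ℕ → ℕ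
G X Y k l = D X Y k ⊓ D Y X l

-- Every table has at most five entries, so index 4 is at or past the last listed value.
D-shift : ∀ X Y i k → 4 ≤ i → D X Y (i + k) ≡ D X Y i + k
D-shift X Y i k 4≤i = look-shift (table X Y) i k (≤-trans (short X Y) (s≤s 4≤i))
  where
  short : ∀ X Y → length (table X Y) ≤ 5
  short = from-yes (allKind? λ X → allKind? λ Y → length (table X Y) ≤? 5)

Linear : (ℕ → ℕ) → Set
Linear f = ∀ k → f (4 + k) ≡ f 4 + k

Linear-D : ∀ X Y i → Linear (λ k → D X Y (i + k))
Linear-D X Y i k = trans (cong (D X Y) (sym (+-assoc i 4 k))) (D-shift X Y (i + 4) k (m≤n+m 4 i))

Linear-1+D : ∀ X Y i → Linear (λ k → suc (D X Y (i + k)))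
Linear-1+D X Y i k = cong suc (Linear-D X Y i k)

-- Both sides have slope 1 from 4 on, so the comparison at 4 propagates. This turns each inequality
-- between ladder distances into a check of five values.
Linear-≤ : ∀ {f g} → Linear f → Linear g → (∀ {k} → k < 5 → f k ≤ g k) → ∀ k → f k ≤ g k
Linear-≤ linf ling near 0 = near (s≤s z≤n)
Linear-≤ linf ling near 1 = near (s≤s (s≤s z≤n))
Linear-≤ linf ling near 2 = near (s≤s (s≤s (s≤s z≤n)))
Linear-≤ linf ling near 3 = near (s≤s (s≤s (s≤s (s≤s z≤n))))
Linear-≤ linf ling near (suc (suc (suc (suc k))))
  rewrite linf k | ling k = +-monoˡ-≤ k (near ≤-refl)

-- These four inequalities say that ladder distance changes by at most 1 when one end moves along an
-- edge. In the `right` pair the far end moves; in the `left` pair the near end moves forwards,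
-- which shortens the arc by `δ l`.
D-rightˡ : ∀ l X k → D X (src l) k ≤ suc (D X (tgt l) (δ l + k))
D-rightˡ l X = Linear-≤ (Linear-D X (src l) 0) (Linear-1+D X (tgt l) (δ l))
  (from-yes (allLink? λ l → allKind? λ X →
    allUpTo? (λ k → D X (src l) k ≤? suc (D X (tgt l) (δ l + k))) 5) l X)

D-rightʳ : ∀ l X k → D X (tgt l) (δ l + k) ≤ suc (D X (src l) k)
D-rightʳ l X = Linear-≤ (Linear-D X (tgt l) (δ l)) (Linear-1+D X (src l) 0)
  (from-yes (allLink? λ l → allKind? λ X →
    allUpTo? (λ k → D X (tgt l) (δ l + k) ≤? suc (D X (src l) k)) 5) l X)

D-leftˡ : ∀ l X k → D (src l) X (δ l + k) ≤ suc (D (tgt l) X k)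
D-leftˡ l X = Linear-≤ (Linear-D (src l) X (δ l)) (Linear-1+D (tgt l) X 0)
  (from-yes (allLink? λ l → allKind? λ X →
    allUpTo? (λ k → D (src l) X (δ l + k) ≤? suc (D (tgt l) X k)) 5) l X)

D-leftʳ : ∀ l X k → D (tgt l) X k ≤ suc (D (src l) X (δ l + k))
D-leftʳ l X = Linear-≤ (Linear-D (tgt l) X 0) (Linear-1+D (src l) X (δ l))
  (from-yes (allLink? λ l → allKind? λ X →
    allUpTo? (λ k → D (tgt l) X k ≤? suc (D (src l) X (δ l + k))) 5) l X)

k≤D : ∀ X Y k → k ≤ D X Y k
k≤D X Y = Linear-≤ (λ _ → refl) (Linear-D X Y 0)
  (from-yes (allKind? λ X → allKind? λ Y → allUpTo? (λ k → k ≤? D X Y k) 5) X Y)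

-- Together with `k≤D` this shows that an arc longer by at least 4 never gives the smaller distance.
-- The slack 4 is attained between two vertices of kind `S`.
D≤k+4 : ∀ X Y k → D X Y k ≤ k + 4
D≤k+4 X Y = Linear-≤ (Linear-D X Y 0) (λ k → cong (4 +_) (+-comm k 4))
  (from-yes (allKind? λ X → allKind? λ Y → allUpTo? (λ k → D X Y k ≤? k + 4) 5) X Y)

D-sym₀ : ∀ X Y → D X Y 0 ≡ D Y X 0
D-sym₀ = from-yes (allKind? λ X → allKind? λ Y → D X Y 0 ≟ D Y X 0)

D₀≤D : ∀ X Y k → D X Y 0 ≤ D X Y k
D₀≤D X Y 0 = ≤-refl
D₀≤D X Y 1 = from-yes (allKind? λ X → allKind? λ Y → D X Y 0 ≤? D X Y 1) X Y
D₀≤D X Y 2 = from-yes (allKind? λ X → allKind? λ Y → D X Y 0 ≤? D X Y 2) X Y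
D₀≤D X Y k@(suc (suc (suc _))) = ≤-trans (from-yes (allKind? λ X → allKind? λ Y → D X Y 0 ≤? 3) X Y)
  (≤-trans (s≤s (s≤s (s≤s z≤n))) (k≤D X Y k))

D-refl₀ : ∀ X → D X X 0 ≡ 0
D-refl₀ = from-yes (allKind? λ X → D X X 0 ≟ 0)

-- Offsets `0` and `n` name the same vertex; both sides equal `D X Y 0`, because a full turn is
-- never shorter than staying at the same position.
G-wrap : ∀ X Y n → G X Y 0 n ≡ G X Y n 0
G-wrap X Y n = trans
  (m≤n⇒m⊓n≡m (subst (_≤ D Y X n) (D-sym₀ Y X) (D₀≤D Y X n)))
  (trans (D-sym₀ X Y) (sym (m≥n⇒m⊓n≡n (subst (_≤ D X Y n) (D-sym₀ X Y) (D₀≤D X Y n)))))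

-- Shortest walks in the ladder.

data Into : Kind × ℕ → Kind × ℕ → Set where
  fwd : ∀ l k → Into (src l , k) (tgt l , δ l + k)
  bwd : ∀ l k → Into (tgt l , δ l + k) (src l , k)

-- Candidates for the last edge of a shortest walk. Only edges that do not lower the position are
-- listed; `descent` shows that these suffice.
into : ∀ Y k → List (∃ λ z → Into z (Y , k))
into P zero    = (_ , bwd PQ 0) ∷ []
into P (suc k) = (_ , fwd PP k) ∷ (_ , bwd PQ (suc k)) ∷ []
into Q zero    = (_ , fwd PQ 0) ∷ (_ , bwd QR 0) ∷ []
into Q (suc k) = (_ , fwd PQ (suc k)) ∷ (_ , fwd RQ k) ∷ (_ , bwd QR (suc k)) ∷ []
into R zero    = (_ , fwd QR 0) ∷ (_ , bwd RS 0) ∷ []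
into R (suc k) = (_ , fwd QR (suc k)) ∷ (_ , fwd SR k) ∷ (_ , bwd RS (suc k)) ∷ []
into S k       = (_ , fwd RS k) ∷ []

Descent : Kind → Kind → ℕ → Set
Descent X Y k =
  (X ≡ Y × k ≡ 0) ⊎ Any (λ (z , _) → D X Y k ≡ suc (uncurry (D X) z)) (into Y k)

-- Small positions are checked by computation. Far out, a shortest walk to `P` arrives along the `P`
-- cycle, and one to `Q`, `R` or `S` arrives from `P`, `Q` or `R` at the same position.
descent : ∀ X Y k → Descent X Y k
descent X Y k with k <? 5
... | yes k<5 = from-yes (allKind? λ X → allKind? λ Y → allUpTo? (λ k →
        ((X ≟ᴷ Y) ×-dec (k ≟ 0)) ⊎-dec any? (λ (z , _) → D X Y k ≟ suc (uncurry (D X) z)) (into Y k)) 5)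
        X Y k<5
... | no k≮5 = subst (Descent X Y) (m+[n∸m]≡n (≮⇒≥ k≮5)) (far Y (k ∸ 5))
  where
  rung : ∀ Y Z → (∀ X → D X Y 5 ≡ suc (D X Z 5)) → ∀ j → D X Y (5 + j) ≡ suc (D X Z (5 + j))
  rung Y Z base j = trans (D-shift X Y 5 j (n≤1+n 4))
    (trans (cong (_+ j) (base X)) (cong suc (sym (D-shift X Z 5 j (n≤1+n 4)))))
  far : ∀ Y j → Descent X Y (5 + j)
  far P j = inj₂ (here (trans (Linear-D X P 0 (suc j))
    (trans (+-suc _ j) (cong suc (sym (Linear-D X P 0 j))))))
  far Q j = inj₂ (here (rung Q P (from-yes (allKind? λ X → D X Q 5 ≟ suc (D X P 5))) j))
  far R j = inj₂ (here (rung R Q (from-yes (allKind? λ X → D X R 5 ≟ suc (D X Q 5))) j))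
  far S j = inj₂ (here (rung S R (from-yes (allKind? λ X → D X S 5 ≟ suc (D X R 5))) j))

-- The distance formula on the circle.

module _ (n : ℕ) .{{_ : NonZero n}} where

  at : Kind → Fin n → V n
  at P = p
  at Q = q
  at R = r
  at S = s

  kind : V n → Kind
  kind (p _) = P
  kind (q _) = Q
  kind (r _) = R
  kind (s _) = S

  index : V n → Fin n
  index (p t) = t
  index (q t) = t
  index (r t) = t
  index (s t) = t

  at-kind-index : ∀ v → at (kind v) (index v) ≡ v
  at-kind-index (p _) = refl
  at-kind-index (q _) = refl
  at-kind-index (r _) = refl
  at-kind-index (s _) = refl

  kind-at : ∀ X t → kind (at X t) ≡ X
  kind-at P t = refl
  kind-at Q t = refl
  kind-at R t = refl
  kind-at S t = refl

  index-at : ∀ X t → index (at X t) ≡ t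
  index-at P t = refl
  index-at Q t = refl
  index-at R t = refl
  index-at S t = refl

  pos : ℕ → Fin n
  pos k = k mod n

  π : Kind → ℕ → V n
  π X k = at X (pos k)

  pos-cong : ∀ {a b} → a % n ≡ b % n → pos a ≡ pos b
  pos-cong {a} {b} eq = fromℕ<-cong _ _ eq (m%n<n a n) (m%n<n b n)

  toℕ-pos : ∀ a → toℕ (pos a) ≡ a % n
  toℕ-pos a = toℕ-fromℕ< (m%n<n a n)

  nxt-pos : ∀ a → nxt n (pos a) ≡ pos (suc a)
  nxt-pos a = pos-cong (begin
    (toℕ (pos a) + 1) % n      ≡⟨ cong (λ z → (z + 1) % n) (toℕ-pos a) ⟩
    (a % n + 1) % n            ≡⟨ %-distribˡ-+ (a % n) 1 n ⟩
    (a % n % n + 1 % n) % n    ≡⟨ cong (λ z → (z + 1 % n) % n) (m%n%n≡m%n a n) ⟩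
    (a % n + 1 % n) % n        ≡⟨ %-distribˡ-+ a 1 n ⟨
    (a + 1) % n                ≡⟨ cong (_% n) (+-comm a 1) ⟩
    suc a % n                  ∎)
    where open ≡-Reasoning

  pos-+n : ∀ a → pos (a + n) ≡ pos a
  pos-+n a = pos-cong ([m+n]%n≡m%n a n)

  shift : ℕ → Fin n → Fin n
  shift zero    t = t
  shift (suc i) t = nxt n (shift i t)

  shift-pos : ∀ i a → shift i (pos a) ≡ pos (i + a)
  shift-pos zero    a = refl
  shift-pos (suc i) a = trans (cong (nxt n) (shift-pos i a)) (nxt-pos (i + a))

  link-edge : ∀ l t → Edge n (at (src l) t) (at (tgt l) (shift (δ l) t))
  link-edge PP = pp
  link-edge PQ = pq
  link-edge QR = qr
  link-edge RS = rs
  link-edge SR = sr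
  link-edge RQ = rq

  edge-link : ∀ {u v} → Edge n u v →
    ∃ λ l → ∃ λ t → u ≡ at (src l) t × v ≡ at (tgt l) (shift (δ l) t)
  edge-link (pp t) = PP , t , refl , refl
  edge-link (pq t) = PQ , t , refl , refl
  edge-link (qr t) = QR , t , refl , refl
  edge-link (rs t) = RS , t , refl , refl
  edge-link (sr t) = SR , t , refl , refl
  edge-link (rq t) = RQ , t , refl , refl

  -- Induction on the base `x`: advancing it by one shortens the forward offset by one and wraps
  -- offset `0` to `n - 1`. Writing the complement as `suc l` records that the offset is below `n`.
  offset : ∀ x t → ∃ λ k → ∃ λ l → k + suc l ≡ n × t ≡ pos (x + k)
  offset zero t = toℕ t , n ∸ suc (toℕ t) , trans (+-suc _ _) (m+[n∸m]≡n (toℕ<n t)) ,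
    sym (toℕ-injective (trans (toℕ-pos (toℕ t)) (m<n⇒m%n≡m (toℕ<n t))))
  offset (suc x) t with offset x t
  ... | suc k , l , eq , t≡ = k , suc l , trans (+-suc k (suc l)) eq , trans t≡ (cong pos (+-suc x k))
  ... | zero  , l , eq , t≡ = l , 0 , trans (+-comm l 1) eq , (begin
    t                 ≡⟨ t≡ ⟩
    pos (x + 0)       ≡⟨ cong pos (+-identityʳ x) ⟩
    pos x             ≡⟨ pos-+n x ⟨
    pos (x + n)       ≡⟨ cong (λ z → pos (x + z)) eq ⟨
    pos (x + suc l)   ≡⟨ cong pos (+-suc x l) ⟩
    pos (suc x + l)   ∎)
    where open ≡-Reasoning

  pos-cancel : ∀ x {k k'} → pos (x + k) ≡ pos (x + k') → k % n ≡ k' % n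
  pos-cancel x {k} {k'} eq = trans (sym (reduce k)) (trans (cong (λ z → (z + c) % n) eq′) (reduce k'))
    where
    open ≡-Reasoning
    -- Adding `pred n * x` undoes the summand `x`, since together they make `n * x`.
    c = pred n * x % n
    eq′ : (x + k) % n ≡ (x + k') % n
    eq′ = trans (sym (toℕ-pos (x + k))) (trans (cong toℕ eq) (toℕ-pos (x + k')))
    reduce : ∀ k → ((x + k) % n + c) % n ≡ k % n
    reduce k = begin
      ((x + k) % n + c) % n       ≡⟨ %-distribˡ-+ (x + k) (pred n * x) n ⟨
      (x + k + pred n * x) % n    ≡⟨ cong (λ z → (z + pred n * x) % n) (+-comm x k) ⟩
      (k + x + pred n * x) % n    ≡⟨ cong (_% n) (+-assoc k x _) ⟩
      (k + suc (pred n) * x) % n  ≡⟨ cong (λ z → (k + z * x) % n) (suc-pred n) ⟩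
      (k + n * x) % n             ≡⟨ cong (λ z → (k + z) % n) (*-comm n x) ⟩
      (k + x * n) % n             ≡⟨ [m+kn]%n≡m%n k x n ⟩
      k % n                       ∎

  pos-injective : ∀ x {k k'} → k < n → k' < n → pos (x + k) ≡ pos (x + k') → k ≡ k'
  pos-injective x k<n k'<n eq =
    trans (sym (m<n⇒m%n≡m k<n)) (trans (pos-cancel x eq) (m<n⇒m%n≡m k'<n))

  -- The formula depends only on the vertex reached: two offsets of at most `n` that agree modulo
  -- `n` are equal or are `0` and `n`, which `G-wrap` settles.
  G-index : ∀ X Y x {k l k' l'} → k + l ≡ n → k' + l' ≡ n →
    pos (x + k) ≡ pos (x + k') → G X Y k l ≡ G X Y k' l'
  G-index X Y x {k} {l} {k'} {l'} eq eq' same = trans (go k l eq) (trans mid (sym (go k' l' eq')))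
    where
    canon : ℕ → ℕ
    canon k = G X Y (k % n) (n ∸ k % n)
    mid : canon k ≡ canon k'
    mid = cong (λ z → G X Y z (n ∸ z)) (pos-cancel x same)
    go : ∀ k l → k + l ≡ n → G X Y k l ≡ canon k
    go k zero eq = subst (λ k → G X Y k 0 ≡ canon k) (trans (sym eq) (+-identityʳ k))
      (trans (sym (G-wrap X Y n)) (cong (λ z → G X Y z (n ∸ z)) (sym (n%n≡0 n))))
    go k (suc l) eq = sym (trans (cong (λ z → G X Y z (n ∸ z)) (m<n⇒m%n≡m k<n))
      (cong (G X Y k) (trans (cong (_∸ k) (sym eq)) (m+n∸m≡n k (suc l)))))
      where
      k<n : k < n
      k<n = subst (k <_) eq (m<m+n k (s≤s z≤n))

  module _ (X : Kind) (x : ℕ) where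

    -- The distance formula as a function on vertices. It changes by at most 1 along an edge,
    -- hence bounds the length of every walk from below.
    potential : V n → ℕ
    potential v with offset x (index v)
    ... | k , l , _ = G X (kind v) k (suc l)

    potential-π : ∀ Y k l → k + l ≡ n → potential (π Y (x + k)) ≡ G X Y k l
    potential-π Y k l eq with offset x (index (π Y (x + k)))
    ... | k' , l' , eq' , t≡ rewrite kind-at Y (pos (x + k)) =
      G-index X Y x eq' eq (trans (sym t≡) (index-at Y (pos (x + k))))

    potential-link : ∀ l t →
      let u = at (src l) t; v = at (tgt l) (shift (δ l) t) in
      potential u ≤ suc (potential v) × potential v ≤ suc (potential u)
    potential-link l t with offset x t
    ... | k , b , eq , refl = 
      subst₂ (λ α β → α ≤ suc β × β ≤ suc α) (sym eq₁) (sym eq₂)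
        ( ⊓-mono-≤ (D-rightˡ l X k) (D-leftˡ l X b₀)
        , ⊓-mono-≤ (D-rightʳ l X k) (D-leftʳ l X b₀))
      where
      δ≤1 : ∀ l → δ l ≤ 1
      δ≤1 = from-yes (allLink? λ l → δ l ≤? 1)
      -- The complementary arc `suc b` is positive, so it can give up `δ l` and the edge does not
      -- run past the base.
      b₀ = suc b ∸ δ l
      split : δ l + b₀ ≡ suc b
      split = m+[n∸m]≡n (≤-trans (δ≤1 l) (s≤s z≤n))
      eq₁ : potential (π (src l) (x + k)) ≡ G X (src l) k (δ l + b₀)
      eq₁ = potential-π (src l) k (δ l + b₀) (trans (cong (k +_) split) eq)
      swap-δ : ∀ a → δ l + (a + k) ≡ a + (δ l + k)
      swap-δ a = trans (sym (+-assoc (δ l) a k)) (trans (cong (_+ k) (+-comm (δ l) a)) (+-assoc a (δ l) k))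
      eq₂ : potential (at (tgt l) (shift (δ l) (pos (x + k)))) ≡ G X (tgt l) (δ l + k) b₀
      eq₂ = trans (cong (potential ∘ at (tgt l)) (trans (shift-pos (δ l) (x + k)) (cong pos (swap-δ x))))
        (potential-π (tgt l) (δ l + k) b₀ (trans (cong (_+ b₀) (+-comm (δ l) k))
          (trans (+-assoc k (δ l) b₀) (trans (cong (k +_) split) eq))))

    potential-adj : ∀ {u v} → Adj n u v → potential v ≤ suc (potential u)
    potential-adj (inj₁ e) with edge-link e
    ... | l , t , refl , refl = proj₂ (potential-link l t)
    potential-adj (inj₂ e) with edge-link e
    ... | l , t , refl , refl = proj₁ (potential-link l t)

    potential-walk : ∀ {u v m} → Walk n u v m → potential v ≤ m + potential u
    potential-walk [] = ≤-refl
    potential-walk {u} (_∷_ {k = m} a w) = ≤-trans (potential-walk w)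
      (≤-trans (+-monoʳ-≤ m (potential-adj a)) (≤-reflexive (+-suc m (potential u))))

    into-adj : ∀ {Z k Y k'} → Into (Z , k) (Y , k') → Adj n (π Z (x + k)) (π Y (x + k'))
    into-adj (fwd l k) = inj₁ (subst (λ t → Edge n (π (src l) (x + k)) (at (tgt l) t)) (shift-x l k) (link-edge l (pos (x + k))))
      where
      shift-x : ∀ l k → shift (δ l) (pos (x + k)) ≡ pos (x + (δ l + k))
      shift-x l k = trans (shift-pos (δ l) (x + k)) (cong pos (trans (sym (+-assoc (δ l) x k))
        (trans (cong (_+ k) (+-comm (δ l) x)) (+-assoc x (δ l) k))))
    into-adj (bwd l k) = swap (into-adj (fwd l k))

    snoc : ∀ {u v w m} → Walk n u v m → Adj n v w → Walk n u w (suc m)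
    snoc []      a = a ∷ []
    snoc (b ∷ w) a = b ∷ snoc w a

    -- Recursion is on the length `m`, because the predecessor supplied by `descent` may have the
    -- same position.
    reach : ∀ m Y k → D X Y k ≡ m → Walk n (π X x) (π Y (x + k)) m
    reach m Y k eq with descent X Y k
    reach m Y k eq | inj₁ (refl , refl) = subst₂ (λ a → Walk n (π X x) (π X a))
      (sym (+-identityʳ x)) (trans (sym (D-refl₀ X)) eq) []
    reach m Y k eq | inj₂ any = step m eq any
      where
      step : ∀ m → D X Y k ≡ m → ∀ {zs} → Any (λ (z , _) → D X Y k ≡ suc (uncurry (D X) z)) zs →
        Walk n (π X x) (π Y (x + k)) m
      step m       eq (there a) = step m eq a
      step zero    eq (here {z , i} d) = contradiction (trans (sym eq) d) λ ()
      step (suc m) eq (here {z , i} d) =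
        snoc (reach m (proj₁ z) (proj₂ z) (suc-injective (trans (sym d) eq))) (into-adj i)

  reverse : ∀ {u v m} → Walk n u v m → Walk n v u m
  reverse []      = []
  reverse (a ∷ w) = snoc P 0 (reverse w) (swap a)

  Dist-sym : ∀ {u v m} → Dist n u v m → Dist n v u m
  Dist-sym (w , min) = reverse w , λ m w' → min m (reverse w')

  Dist-unique : ∀ {u v m m'} → Dist n u v m → Dist n u v m' → m ≡ m'
  Dist-unique (w , min) (w' , min') = ≤-antisym (min _ w') (min' _ w)

  -- The better arc supplies a walk. No walk is shorter, because the potential is 0 at its start and
  -- rises by at most 1 per edge.
  Dist-π : ∀ X Y x k l → k + l ≡ n → Dist n (π X x) (π Y (x + k)) (G X Y k l)
  Dist-π X Y x k l eq = walk , bound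
    where
    walk : Walk n (π X x) (π Y (x + k)) (G X Y k l)
    walk with ⊓-sel (D X Y k) (D Y X l)
    ... | inj₁ e = subst (Walk n _ _) (sym e) (reach X x _ Y k refl)
    -- The other arc runs from `Y` forwards by `l`, reaching `X` one full turn after `x`.
    ... | inj₂ e = subst (Walk n _ _) (sym e) (reverse (subst (λ t → Walk n _ (at X t) _)
      (trans (cong pos (trans (+-assoc x k l) (cong (x +_) eq))) (pos-+n x)) (reach Y (x + k) _ X l refl)))
    start : potential X x (π X x) ≡ 0
    start = trans (cong (potential X x ∘ π X) (sym (+-identityʳ x)))
      (trans (potential-π X x X 0 n refl) (cong (_⊓ D X X n) (D-refl₀ X)))
    bound : ∀ m → Walk n (π X x) (π Y (x + k)) m → G X Y k l ≤ m
    bound m w = subst₂ _≤_ (potential-π X x Y k l eq) (trans (cong (m +_) start) (+-identityʳ m))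
      (potential-walk X x w)

-- Distances under lengthening of the arcs.

G-saturated : ∀ X Y k l → k + 4 ≤ l → G X Y k l ≡ D X Y k
G-saturated X Y k l k+4≤l = m≤n⇒m⊓n≡m (≤-trans (D≤k+4 X Y k) (≤-trans k+4≤l (k≤D Y X l)))

G-shift : ∀ X Y k l t → 4 ≤ k → 4 ≤ l → G X Y (k + t) (l + t) ≡ G X Y k l + t
G-shift X Y k l t 4≤k 4≤l = trans (cong₂ _⊓_ (D-shift X Y k t 4≤k) (D-shift Y X l t 4≤l))
  (sym (+-distribʳ-⊓ t (D X Y k) (D Y X l)))

-- The distance from X_x to Y_y in Δ_n provided ∣ x - y ∣ ≤ n; junk otherwise.
dist : ℕ → Kind → ℕ → Kind → ℕ → ℕ
dist n X zero    Y y       = G X Y y (n ∸ y)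
dist n X (suc x) Y zero    = G Y X (suc x) (n ∸ suc x)
dist n X (suc x) Y (suc y) = dist n X x Y y

ladder : Kind → ℕ → Kind → ℕ → ℕ
ladder X zero    Y y       = D X Y y
ladder X (suc x) Y zero    = D Y X (suc x)
ladder X (suc x) Y (suc y) = ladder X x Y y

dist-saturated : ∀ n X x Y y → ∣ x - y ∣ + (∣ x - y ∣ + 4) ≤ n → dist n X x Y y ≡ ladder X x Y y
dist-saturated n X zero    Y y       h = G-saturated X Y y _ (m+n≤o⇒m≤o∸n _ (subst (_≤ n) (+-comm y _) h))
dist-saturated n X (suc x) Y zero    h =
  G-saturated Y X (suc x) _ (m+n≤o⇒m≤o∸n _ (subst (_≤ n) (+-comm (suc x) _) h))
dist-saturated n X (suc x) Y (suc y) h = dist-saturated n X x Y y h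

dist-translate : ∀ n X x Y y j → dist n X (j + x) Y (j + y) ≡ dist n X x Y y
dist-translate n X x Y y zero    = refl
dist-translate n X x Y y (suc j) = dist-translate n X x Y y j

-- Of the added length `t + t` each arc receives `t`, and both are already in the range of slope 1.
G-shift-∸ : ∀ n X Y k t → 4 ≤ k → k + 4 ≤ n →
  G X Y (k + t) (n + (t + t) ∸ (k + t)) ≡ G X Y k (n ∸ k) + t
G-shift-∸ n X Y k t 4≤k k+4≤n = trans (cong (G X Y (k + t)) regroup)
  (G-shift X Y k (n ∸ k) t 4≤k (m+n≤o⇒m≤o∸n 4 (subst (_≤ n) (+-comm k 4) k+4≤n)))
  where
  regroup : n + (t + t) ∸ (k + t) ≡ (n ∸ k) + t
  regroup = trans (cong₂ _∸_ (sym (+-assoc n t t)) (+-comm k t))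
    (trans (cong (_∸ (t + k)) (+-comm (n + t) t))
    (trans ([m+n]∸[m+o]≡n∸o t (n + t) k) (+-∸-comm t (≤-trans (m≤m+n k 4) k+4≤n))))

-- The two inequalities put both arcs between the positions at length 4 or more.
dist-shiftˡ : ∀ n X x Y y t → y + 4 ≤ x → x + 4 ≤ n + y →
  dist (n + (t + t)) X (x + t) Y y ≡ dist n X x Y y + t
dist-shiftˡ n X (suc x) Y zero    t h h' =
  G-shift-∸ n Y X (suc x) t h (subst (_ ≤_) (+-identityʳ n) h')
dist-shiftˡ n X (suc x) Y (suc y) t (s≤s h) h' =
  dist-shiftˡ n X x Y y t h (s≤s⁻¹ (≤-trans h' (≤-reflexive (+-suc n y))))

dist-shiftʳ : ∀ n X x Y y t → x + 4 ≤ y → y + 4 ≤ n + x →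
  dist (n + (t + t)) X x Y (y + t) ≡ dist n X x Y y + t
dist-shiftʳ n X zero    Y y       t h       h' =
  G-shift-∸ n X Y y t h (subst (_ ≤_) (+-identityʳ n) h')
dist-shiftʳ n X (suc x) Y (suc y) t (s≤s h) h' =
  dist-shiftʳ n X x Y y t h (s≤s⁻¹ (≤-trans h' (≤-reflexive (+-suc n x))))

-- Pairs equidistant from two landmarks.

-- The two landmarks are X_3 and Y_{j+3}, so that positions z ≤ 6 are those within 3 of X_3,
-- and positions j + z with z ≤ 6 those within 3 of Y_{j+3}.
data Anchor : Set where
  first second : Anchor

locate : Anchor → ℕ → ℕ → ℕ
locate first  j z = z
locate second j z = j + z

Pair : Set
Pair = Anchor × (Kind × ℕ) × (Kind × ℕ)

-- The arcs between the landmarks have lengths `j` and `j + e`. Distinctness is stated so that it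
-- survives reduction modulo any `n` of at least 6: the kinds differ, or the positions differ by 1
-- to 5.
Conflict : Kind → Kind → ℕ → ℕ → Pair → Set
Conflict X Y j e (A , (U , z) , (V , w)) =
  z ≤ 6 × w ≤ 6 × (U ≢ V ⊎ z < w × w ≤ z + 5) ×
  dist n X 3 U (locate A j z) ≡ dist n X 3 V (locate A j w) ×
  dist n Y (j + 3) U (locate A j z) ≡ dist n Y (j + 3) V (locate A j w)
  where n = j + j + e

conflict? : ∀ X Y j e c → Dec (Conflict X Y j e c)
conflict? X Y j e (A , (U , z) , (V , w)) =
  (z ≤? 6) ×-dec (w ≤? 6) ×-dec (¬? (U ≟ᴷ V) ⊎-dec (z <? w) ×-dec (w ≤? z + 5)) ×-dec
  (_ ≟ _) ×-dec (_ ≟ _)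

-- Found by a computer search (greedy set cover over the cases of conflict-small).
pairs : List Pair
pairs =
  (second , (Q , 4) , (S , 2)) ∷
  (first  , (Q , 5) , (S , 4)) ∷
  (second , (P , 4) , (Q , 3)) ∷
  (second , (S , 2) , (S , 3)) ∷
  (second , (Q , 1) , (S , 0)) ∷
  (first  , (S , 2) , (S , 3)) ∷
  (second , (P , 1) , (P , 5)) ∷
  (second , (P , 1) , (R , 2)) ∷
  (second , (P , 4) , (R , 5)) ∷
  (first  , (P , 2) , (S , 2)) ∷
  (first  , (P , 2) , (S , 5)) ∷
  (first  , (P , 5) , (R , 2)) ∷ []

-- The extreme cases `j = 7` and `e = 10` stand for all larger values, through `conflict-stretch`
-- and `conflict-widen`.
conflict-small : ∀ X Y {j} → j < 8 → ∀ {e} → e < 11 → 6 ≤ j + j + e → Any (Conflict X Y j e) pairs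
conflict-small = from-yes (allKind? λ X → allKind? λ Y → allUpTo? (λ j → allUpTo? (λ e →
  (6 ≤? j + j + e) →-dec any? (conflict? X Y j e) pairs) 11) 8)

-- For e ≥ 10 every distance involved is attained along a walk that avoids the long arc
-- between the landmarks, so lengthening that arc changes nothing.
conflict-widen : ∀ X Y j e → j < 8 → ∀ c → Conflict X Y j 10 c → Conflict X Y j (10 + e) c
conflict-widen X Y j e j<8 (A , (U , z) , (V , w)) (z≤6 , w≤6 , distinct , eqX , eqY) =
  z≤6 , w≤6 , distinct ,
  widen X 3 (locate A j z) (locate A j w) (near A z≤6) (near A w≤6) eqX ,
  widen Y (j + 3) (locate A j z) (locate A j w) (far A z≤6) (far A w≤6) eqY
  where
  n n' : ℕ
  n  = j + j + 10
  n' = j + j + (10 + e)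
  Short : ℕ → ℕ → Set
  Short x y = ∣ x - y ∣ + (∣ x - y ∣ + 4) ≤ n
  short? : ∀ j x y → Dec (∣ x - y ∣ + (∣ x - y ∣ + 4) ≤ j + j + 10)
  short? j x y = _ ≤? _
  near : ∀ A {z} → z ≤ 6 → Short 3 (locate A j z)
  near first  z≤6 = from-yes (allUpTo? (λ j → allUpTo? (λ z → short? j 3 z) 7) 8) j<8 (s≤s z≤6)
  near second z≤6 = from-yes (allUpTo? (λ j → allUpTo? (λ z → short? j 3 (j + z)) 7) 8) j<8 (s≤s z≤6)
  far : ∀ A {z} → z ≤ 6 → Short (j + 3) (locate A j z)
  far first  z≤6 = from-yes (allUpTo? (λ j → allUpTo? (λ z → short? j (j + 3) z) 7) 8) j<8 (s≤s z≤6)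
  far second z≤6 = from-yes (allUpTo? (λ j → allUpTo? (λ z → short? j (j + 3) (j + z)) 7) 8) j<8 (s≤s z≤6)
  n≤n' : n ≤ n'
  n≤n' = +-monoʳ-≤ (j + j) (m≤m+n 10 e)
  same : ∀ X x Y y → Short x y → dist n' X x Y y ≡ dist n X x Y y
  same X x Y y h =
    trans (dist-saturated n' X x Y y (≤-trans h n≤n')) (sym (dist-saturated n X x Y y h))
  widen : ∀ Z x y y' → Short x y → Short x y' →
    dist n Z x U y ≡ dist n Z x V y' → dist n' Z x U y ≡ dist n' Z x V y'
  widen Z x y y' h h' eq = trans (same Z x U y h) (trans eq (sym (same Z x V y' h')))

-- Lengthening both arcs by t fixes the distances to the near landmark and adds t to
-- those to the far one.
conflict-stretch : ∀ X Y t e c → Conflict X Y 7 e c → Conflict X Y (7 + t) e c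
conflict-stretch X Y t e (A , (U , z) , (V , w)) (z≤6 , w≤6 , distinct , eqX , eqY) =
  z≤6 , w≤6 , distinct , stretch A eqX eqY
  where
  n n' : ℕ
  n  = 14 + e
  n' = 7 + t + (7 + t) + e
  n'≡ : n' ≡ n + (t + t)
  n'≡ = solve 2 (λ t e → con 7 :+ t :+ (con 7 :+ t) :+ e := con 14 :+ e :+ (t :+ t)) refl t e
  Near : ∀ {z} → z ≤ 6 → ∣ 3 - z ∣ + (∣ 3 - z ∣ + 4) ≤ 10
  Near z≤6 = from-yes (allUpTo? (λ z → ∣ 3 - z ∣ + (∣ 3 - z ∣ + 4) ≤? 10) 7) (s≤s z≤6)
  near : ∀ Z U {z} → z ≤ 6 → dist n' Z 3 U z ≡ dist n Z 3 U z
  near Z U {z} z≤6 = trans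
    (dist-saturated n' Z 3 U z (≤-trans (Near z≤6) (subst (10 ≤_) (sym n'≡) (m≤m+n 10 _))))
    (sym (dist-saturated n Z 3 U z (≤-trans (Near z≤6) (m≤m+n 10 _))))
  farˡ : ∀ Z U {z} → z ≤ 6 → dist n' Z (7 + t + 3) U z ≡ dist n Z 10 U z + t
  farˡ Z U {z} z≤6 = trans (cong₂ (λ n x → dist n Z x U z) n'≡ (cong (7 +_) (+-comm t 3)))
    (dist-shiftˡ n Z 10 U z t (+-monoˡ-≤ 4 z≤6) (m≤m+n 14 _ ))
  farʳ : ∀ Z U {z} → z ≤ 6 → dist n' Z 3 U (7 + t + z) ≡ dist n Z 3 U (7 + z) + t
  farʳ Z U {z} z≤6 = trans (cong₂ (λ n x → dist n Z 3 U x) n'≡ (cong (7 +_) (+-comm t z)))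
    (dist-shiftʳ n Z 3 U (7 + z) t (m≤m+n 7 z)
      (≤-trans (+-monoˡ-≤ 4 (+-monoʳ-≤ 7 z≤6)) (≤-trans (m≤m+n 17 e) (≤-reflexive (+-comm 3 n)))))
  stretch : ∀ A →
    dist n X 3 U (locate A 7 z) ≡ dist n X 3 V (locate A 7 w) →
    dist n Y 10 U (locate A 7 z) ≡ dist n Y 10 V (locate A 7 w) →
    dist n' X 3 U (locate A (7 + t) z) ≡ dist n' X 3 V (locate A (7 + t) w) ×
    dist n' Y (7 + t + 3) U (locate A (7 + t) z) ≡ dist n' Y (7 + t + 3) V (locate A (7 + t) w)
  stretch first eqX eqY =
    trans (near X U z≤6) (trans eqX (sym (near X V w≤6))) ,
    trans (farˡ Y U z≤6) (trans (cong (_+ t) eqY) (sym (farˡ Y V w≤6)))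
  stretch second eqX eqY =
    trans (farʳ X U z≤6) (trans (cong (_+ t) eqX) (sym (farʳ X V w≤6))) ,
    trans (dist-translate n' Y 3 U z (7 + t)) (trans (near Y U z≤6)
      (trans eqY (trans (sym (near Y V w≤6)) (sym (dist-translate n' Y 3 V w (7 + t))))))

conflict-narrow : ∀ X Y e {j} → j < 8 → 6 ≤ j + j + e → ∃ (Conflict X Y j e)
conflict-narrow X Y e {j} j<8 6≤n with e <? 11
... | yes e<11 = satisfied (conflict-small X Y j<8 e<11 6≤n)
... | no e≮11 = subst (λ e → ∃ (Conflict X Y j e)) (m+[n∸m]≡n (≤-trans (n≤1+n 10) (≮⇒≥ e≮11)))
  (map₂ (λ {c} → conflict-widen X Y j (e ∸ 10) j<8 c)
    (satisfied (conflict-small X Y j<8 {10} ≤-refl (≤-trans (m≤m+n 6 4) (m≤n+m 10 (j + j))))))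

conflict : ∀ X Y j e → 6 ≤ j + j + e → ∃ (Conflict X Y j e)
conflict X Y j e 6≤n with j <? 8
... | yes j<8 = conflict-narrow X Y e j<8 6≤n
... | no j≮8 = subst (λ j → ∃ (Conflict X Y j e)) (m+[n∸m]≡n (≤-trans (n≤1+n 7) (≮⇒≥ j≮8)))
  (map₂ (λ {c} → conflict-stretch X Y (j ∸ 7) e c) (conflict-narrow X Y e {7} ≤-refl (m≤m+n 6 (8 + e))))

∣-∣≤ : ∀ x y n → x ≤ n + y → y ≤ n + x → ∣ x - y ∣ ≤ n
∣-∣≤ zero    y       n h h' = ≤-trans h' (≤-reflexive (+-identityʳ n))
∣-∣≤ (suc x) zero    n h h' = ≤-trans h (≤-reflexive (+-identityʳ n))
∣-∣≤ (suc x) (suc y) n h h' = ∣-∣≤ x y n (s≤s⁻¹ (≤-trans h (≤-reflexive (+-suc n y))))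
  (s≤s⁻¹ (≤-trans h' (≤-reflexive (+-suc n x))))

-- Lower bound: no two vertices resolve the graph.

module _ (n : ℕ) .{{_ : NonZero n}} where

  Equidistant : V n → V n → V n → Set
  Equidistant u v y = ∃ λ k → Dist n y u k × Dist n y v k

  not-separated : ∀ {u v y} → Equidistant u v y →
    ¬ (∃ λ k → ∃ λ k' → Dist n y u k × Dist n y v k' × k ≢ k')
  not-separated (_ , d , d') (_ , _ , e , e' , k≢k') =
    k≢k' (trans (Dist-unique n e d) (Dist-unique n d' e'))

  Unresolved : V n → V n → Set
  Unresolved a b = ∃ λ u → ∃ λ v → u ≢ v × Equidistant u v a × Equidistant u v b

  π-injective : ∀ {U V} x y → π n U x ≡ π n V y → U ≡ V × pos n x ≡ pos n y
  π-injective {U} {V} x y eq =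
    trans (sym (kind-at n U (pos n x))) (trans (cong (kind n) eq) (kind-at n V (pos n y))) ,
    trans (sym (index-at n U (pos n x))) (trans (cong (index n) eq) (index-at n V (pos n y)))

  -- A successor common to both positions is moved into `o`, until one position is the base and
  -- `Dist-π` applies.
  Dist-dist : ∀ o X x Y y → ∣ x - y ∣ ≤ n →
    Dist n (π n X (o + x)) (π n Y (o + y)) (dist n X x Y y)
  Dist-dist o X zero    Y y       y≤n = subst (λ o' → Dist n (π n X o') (π n Y (o + y)) (G X Y y (n ∸ y)))
    (sym (+-identityʳ o)) (Dist-π n X Y o y (n ∸ y) (m+[n∸m]≡n y≤n))
  Dist-dist o X (suc x) Y zero    x≤n = subst (λ o' → Dist n (π n X (o + suc x)) (π n Y o') (G Y X (suc x) (n ∸ suc x)))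
    (sym (+-identityʳ o)) (Dist-sym n (Dist-π n Y X o (suc x) (n ∸ suc x) (m+[n∸m]≡n x≤n)))
  Dist-dist o X (suc x) Y (suc y) h = subst₂ (λ a b → Dist n (π n X a) (π n Y b) (dist n X x Y y))
    (sym (+-suc o x)) (sym (+-suc o y)) (Dist-dist (suc o) X x Y y h)

  module _ (6≤n : 6 ≤ n) where

    unresolved-near : ∀ X Y o j e → j + j + e ≡ n → Unresolved (π n X (o + 3)) (π n Y (o + (j + 3)))
    unresolved-near X Y o j e refl with conflict X Y j e 6≤n
    ... | (A , (U , z) , (V , w)) , z≤6 , w≤6 , distinct , eqX , eqY =
      π n U (o + locate A j z) , π n V (o + locate A j w) , u≢v distinct ,
      equidistant X 3 (near A z≤6) (near A w≤6) eqX ,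
      equidistant Y (j + 3) (far A z≤6) (far A w≤6) eqY
      where
      equidistant : ∀ Z x {y y'} → ∣ x - y ∣ ≤ n → ∣ x - y' ∣ ≤ n → dist n Z x U y ≡ dist n Z x V y' →
        Equidistant (π n U (o + y)) (π n V (o + y')) (π n Z (o + x))
      equidistant Z x {y} {y'} h h' eq = _ , Dist-dist o Z x U y h ,
        subst (Dist n _ _) (sym eq) (Dist-dist o Z x V y' h')
      3≤n : 3 ≤ n
      3≤n = ≤-trans (m≤m+n 3 3) 6≤n
      j+3≤n : j + 3 ≤ n
      j+3≤n with j ≤? 3
      ... | yes j≤3 = ≤-trans (+-monoˡ-≤ 3 j≤3) 6≤n
      ... | no j≰3 = ≤-trans (+-monoʳ-≤ j (<⇒≤ (≰⇒> j≰3))) (m≤m+n (j + j) e)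
      near : ∀ A {z} → z ≤ 6 → ∣ 3 - locate A j z ∣ ≤ n
      near first  {z} z≤6 = ∣-∣≤ 3 z n (≤-trans 3≤n (m≤m+n n z)) (≤-trans (≤-trans z≤6 6≤n) (m≤m+n n 3))
      near second {z} z≤6 = ∣-∣≤ 3 (j + z) n (≤-trans 3≤n (m≤m+n n (j + z)))
        (≤-trans (+-monoʳ-≤ j z≤6) (≤-trans (≤-reflexive (sym (+-assoc j 3 3))) (+-monoˡ-≤ 3 j+3≤n)))
      far : ∀ A {z} → z ≤ 6 → ∣ j + 3 - locate A j z ∣ ≤ n
      far first  {z} z≤6 = ∣-∣≤ (j + 3) z n (≤-trans j+3≤n (m≤m+n n z))
        (≤-trans (≤-trans z≤6 6≤n) (m≤m+n n (j + 3)))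
      far second {z} z≤6 = ∣-∣≤ (j + 3) (j + z) n (≤-trans j+3≤n (m≤m+n n (j + z)))
        (≤-trans (+-monoʳ-≤ j z≤6) (≤-trans (≤-reflexive (+-comm j 6)) (+-mono-≤ 6≤n (m≤m+n j 3))))
      base : ∀ A z → ∃ λ c → ∀ z → o + locate A j z ≡ c + z
      base first  z = o , λ _ → refl
      base second z = o + j , λ z → sym (+-assoc o j z)
      u≢v : U ≢ V ⊎ z < w × w ≤ z + 5 → π n U (o + locate A j z) ≢ π n V (o + locate A j w)
      u≢v (inj₁ U≢V) eq = U≢V (proj₁ (π-injective _ _ eq))
      u≢v (inj₂ (z<w , w≤z+5)) eq with base A 0
      -- The gap `w ∸ z` is positive and below `n`, hence not congruent to 0.
      ... | c , shifted = <⇒≢ (m<n⇒0<n∸m z<w) (pos-injective n (c + z)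
        (≤-trans (s≤s z≤n) 6≤n)
        (≤-trans (s≤s (m≤n+o⇒m∸n≤o w z w≤z+5)) 6≤n)
        (begin
          pos n (c + z + 0)           ≡⟨ cong (pos n) (trans (+-identityʳ (c + z)) (sym (shifted z))) ⟩
          pos n (o + locate A j z)    ≡⟨ proj₂ (π-injective _ _ eq) ⟩
          pos n (o + locate A j w)    ≡⟨ cong (pos n) (shifted w) ⟩
          pos n (c + w)               ≡⟨ cong (λ w → pos n (c + w)) (m+[n∸m]≡n (<⇒≤ z<w)) ⟨
          pos n (c + (z + (w ∸ z)))   ≡⟨ cong (pos n) (+-assoc c z (w ∸ z)) ⟨
          pos n (c + z + (w ∸ z))     ∎))
        where open ≡-Reasoning

    -- If the arc from `X` to `Y` is the longer one, the landmarks exchange roles: `Y` becomes the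
    -- first, and `X` follows `l` later, one full turn after its original position.
    unresolved-π : ∀ X Y o k l → k + l ≡ n → Unresolved (π n X (o + 3)) (π n Y (o + 3 + k))
    unresolved-π X Y o k l eq with k ≤? l
    ... | yes k≤l = subst (λ y → Unresolved (π n X (o + 3)) (π n Y y))
      (trans (cong (o +_) (+-comm k 3)) (sym (+-assoc o 3 k)))
      (unresolved-near X Y o k (l ∸ k) (trans (+-assoc k k (l ∸ k)) (trans (cong (k +_) (m+[n∸m]≡n k≤l)) eq)))
    ... | no k≰l with unresolved-near Y X (o + k) l (k ∸ l)
                      (trans (+-assoc l l (k ∸ l)) (trans (cong (l +_) (m+[n∸m]≡n (≰⇒≥ k≰l))) (trans (+-comm l k) eq)))
    ...   | u , v , u≢v , eqY , eqX = u , v , u≢v ,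
      subst (Equidistant u v) (cong (at n X) (trans (cong (pos n) round) (pos-+n n (o + 3)))) eqX ,
      subst (Equidistant u v) (cong (π n Y) (solve 2 (λ o k → o :+ k :+ con 3 := o :+ con 3 :+ k) refl o k)) eqY
      where
      round : o + k + (l + 3) ≡ o + 3 + n
      round = trans (solve 3 (λ o k l → o :+ k :+ (l :+ con 3) := o :+ con 3 :+ (k :+ l)) refl o k l)
        (cong (o + 3 +_) eq)

    unresolved : ∀ a b → Unresolved a b
    unresolved a b = subst₂ Unresolved a≡ b≡
      (unresolved-π (kind n a) (kind n b) o (proj₁ off) (suc (proj₁ (proj₂ off))) (proj₁ (proj₂ (proj₂ off))))
      where
      -- Adding `n ∸ 3` replaces subtracting 3, so that `o + 3` is the index of `a` modulo `n`.
      o = toℕ (index n a) + (n ∸ 3)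
      off = offset n (o + 3) (index n b)
      b≡ = trans (cong (at n (kind n b)) (sym (proj₂ (proj₂ (proj₂ off))))) (at-kind-index n b)
      o+3 : o + 3 ≡ toℕ (index n a) + n
      o+3 = trans (+-assoc _ (n ∸ 3) 3) (cong (toℕ (index n a) +_) (m∸n+n≡m (≤-trans (m≤m+n 3 3) 6≤n)))
      pos-toℕ : ∀ t → pos n (toℕ t) ≡ t
      pos-toℕ t = toℕ-injective (trans (toℕ-pos n (toℕ t)) (m<n⇒m%n≡m (toℕ<n t)))
      a≡ : π n (kind n a) (o + 3) ≡ a
      a≡ = trans (cong (at n (kind n a)) (trans (cong (pos n) o+3) (trans (pos-+n n _) (pos-toℕ (index n a)))))
        (at-kind-index n a)

    -- A single landmark is treated as a pair of equal ones.
    resolving⇒3≤length : ∀ Y → Resolving n Y → 3 ≤ length Y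
    resolving⇒3≤length [] res with unresolved (π n P 0) (π n P 0)
    ... | u , v , u≢v , _ with res u v u≢v
    ...   | _ , () , _
    resolving⇒3≤length (a ∷ []) res with unresolved a a
    ... | u , v , u≢v , same , _ with res u v u≢v
    ...   | y , here refl , d = contradiction d (not-separated same)
    resolving⇒3≤length (a ∷ b ∷ []) res with unresolved a b
    ... | u , v , u≢v , sameA , sameB with res u v u≢v
    ...   | y , here refl , d = contradiction d (not-separated sameA)
    ...   | y , there (here refl) , d = contradiction d (not-separated sameB)
    resolving⇒3≤length (_ ∷ _ ∷ _ ∷ _) res = s≤s (s≤s (s≤s z≤n))

-- Distances along one side of the circle.

H : Kind → Kind → ℕ → ℕ → ℕ → ℕ → ℕ
H X Y a c k l = G X Y (a + k) (c + (k + (l + l)))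

k≤H : ∀ X Y a c k l → k ≤ H X Y a c k l
k≤H X Y a c k l = ⊓-glb (≤-trans (m≤n+m k a) (k≤D X Y (a + k)))
  (≤-trans (m≤m+n k (l + l)) (≤-trans (m≤n+m _ c) (k≤D Y X _)))

H-saturated : ∀ X Y a c k l → a ≤ c → 2 ≤ l → H X Y a c k l ≡ D X Y (a + k)
H-saturated X Y a c k l a≤c 2≤l = G-saturated X Y (a + k) _
  (≤-trans (≤-reflexive (+-assoc a k 4)) (+-mono-≤ a≤c (+-monoʳ-≤ k (+-mono-≤ 2≤l 2≤l))))

-- Raising `k` lengthens both arcs and raising `l` only the longer one. So capping `l` at 5 changes
-- nothing, as the shorter arc already decides for `l` at least 2, while capping `k` lowers the
-- distance by the amount cut off.
H-cap : ∀ X Y a c k l → a ≤ c → H X Y a c k l + k ⊓ 5 ≡ H X Y a c (k ⊓ 5) (l ⊓ 5) + k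
H-cap X Y a c k l a≤c = trans (along k) (cong (_+ k) (across l))
  where
  across : ∀ l → H X Y a c (k ⊓ 5) l ≡ H X Y a c (k ⊓ 5) (l ⊓ 5)
  across l with l ≤? 5
  ... | yes l≤5 = cong (H X Y a c (k ⊓ 5)) (sym (m≤n⇒m⊓n≡m l≤5))
  ... | no l≰5 = trans (H-saturated X Y a c _ l a≤c (≤-trans (m≤m+n 2 3) 5≤l))
    (sym (H-saturated X Y a c _ (l ⊓ 5) a≤c (⊓-glb (≤-trans (m≤m+n 2 3) 5≤l) (m≤m+n 2 3))))
    where
    5≤l : 5 ≤ l
    5≤l = ≰⇒≥ l≰5
  along : ∀ k → H X Y a c k l + k ⊓ 5 ≡ H X Y a c (k ⊓ 5) l + k
  along k with k ≤? 5
  ... | yes k≤5 rewrite m≤n⇒m⊓n≡m k≤5 = refl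
  ... | no k≰5 rewrite m≥n⇒m⊓n≡n (≰⇒≥ k≰5) = subst (λ k → H X Y a c k l + 5 ≡ H X Y a c 5 l + k)
    (m+[n∸m]≡n (≰⇒≥ k≰5)) (begin
      G X Y (a + (5 + j)) (c + (5 + j + (l + l))) + 5
        ≡⟨ cong₂ (λ α β → G X Y α β + 5) (sym (+-assoc a 5 j))
             (solve 3 (λ c j l → c :+ (con 5 :+ j :+ (l :+ l)) := c :+ (con 5 :+ (l :+ l)) :+ j) refl c j l) ⟩
      G X Y (a + 5 + j) (c + (5 + (l + l)) + j) + 5
        ≡⟨ cong (_+ 5) (G-shift X Y (a + 5) (c + (5 + (l + l))) j (≤-trans (n≤1+n 4) (m≤n+m 5 a))
             (≤-trans (m≤m+n 4 (1 + (l + l))) (m≤n+m _ c))) ⟩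
      G X Y (a + 5) (c + (5 + (l + l))) + j + 5
        ≡⟨ trans (+-assoc _ j 5) (cong (G X Y (a + 5) (c + (5 + (l + l))) +_) (+-comm j 5)) ⟩
      G X Y (a + 5) (c + (5 + (l + l))) + (5 + j) ∎)
    where
    open ≡-Reasoning
    j = k ∸ 5

-- Side coordinates and decoding of the distance triple.

-- For n = 2m + e with e ≤ 1, the landmarks are P_0, P_m and R_0. A vertex U_t lies on the
-- right if t = k ≤ m, with l = m − k, and on the left if t = m + 1 + l and n = t + 1 + k.
data Side : Set where
  right left : Side

infix 4 _≟ˢ_

_≟ˢ_ : (σ τ : Side) → Dec (σ ≡ τ)
right ≟ˢ right = yes refl
right ≟ˢ left  = no λ ()
left  ≟ˢ right = no λ ()
left  ≟ˢ left  = yes refl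

allSide? : {A : Side → Set} → (∀ σ → Dec (A σ)) → Dec (∀ σ → A σ)
allSide? A? = map′ (λ { (a , b) right → a ; (a , b) left → b }) (λ f → f right , f left)
  (A? right ×-dec A? left)

-- The value is `m`: on the left, `2m + e = n = m + 2 + k + l`.
half : Side → ℕ → ℕ → ℕ → ℕ
half right e k l = k + l
half left  e k l = k + l + (2 ∸ e)

-- On the left the arc from the vertex forwards to the origin has length `1 + k`, leaving
-- `3 ∸ e + k + 2l` for the other.
fromOrigin : Kind → Side → ℕ → Kind → ℕ → ℕ → ℕ
fromOrigin Z right e U k l = H Z U 0 e k l
fromOrigin Z left  e U k l = H U Z 1 (3 ∸ e) k l

fromMiddle : Side → ℕ → Kind → ℕ → ℕ → ℕ
fromMiddle right e U k l = H U P 0 e l k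
fromMiddle left  e U k l = H P U 1 (3 ∸ e) l k

Key Info : Set
Key  = ℕ × ℕ × ℕ × ℕ
Info = Side × Kind × ℕ

-- In the interior of either side, a = k + const, b = l + const and c = k + const, so
-- a + b − m and c − a identify the side and the kind there; the truncated values
-- settle the vertices near the landmarks. The 5 keeps c − a nonnegative.
key : ℕ → ℕ → ℕ → ℕ → Key
key m a b c = a + b ∸ m , c + 5 ∸ a , a ⊓ 5 , b ⊓ 5

keyAt : Side → ℕ → Kind → ℕ → ℕ → Key
keyAt σ e U k l = key (half σ e k l) (fromOrigin P σ e U k l) (fromMiddle σ e U k l) (fromOrigin R σ e U k l)

-- The excess of the distance over `k` is stored instead of `k`: it is unchanged by capping, and
-- together with the distance it gives back `k`.
infoAt : Side → ℕ → Kind → ℕ → ℕ → Info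
infoAt σ e U k l = σ , U , fromOrigin P σ e U k l ∸ k

entries : ℕ → List (Key × Info)
entries e =
  concatMap (λ σ → concatMap (λ U → concatMap (λ k → concatMap (λ l →
    if 3 ≤ᵇ half σ e k l then (keyAt σ e U k l , infoAt σ e U k l) ∷ [] else [])
  (upTo 6)) (upTo 6)) (P ∷ Q ∷ R ∷ S ∷ [])) (right ∷ left ∷ [])

lookupKey : List (Key × Info) → Key → Maybe Info
lookupKey [] _ = nothing
lookupKey (((x , y , z , w) , i) ∷ es) κ@(x' , y' , z' , w') =
  if (x ≡ᵇ x') ∧ (y ≡ᵇ y') ∧ (z ≡ᵇ z') ∧ (w ≡ᵇ w') then just i else lookupKey es κ

-- Since the lookup returns the first match, this forces entries with equal keys to carry equal
-- information.
Decodes : ℕ → List (Key × Info) → Set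
Decodes e es = ∀ σ U {k} → k < 6 → ∀ {l} → l < 6 → 3 ≤ half σ e k l →
  lookupKey es (keyAt σ e U k l) ≡ just (infoAt σ e U k l)

decodes? : ∀ e es → Dec (Decodes e es)
decodes? e es = allSide? λ σ → allKind? λ U → allUpTo? (λ k → allUpTo? (λ l →
  (3 ≤? half σ e k l) →-dec Maybe.≡-dec (Product.≡-dec _≟ˢ_ (Product.≡-dec _≟ᴷ_ _≟_))
    (lookupKey es (keyAt σ e U k l)) (just (infoAt σ e U k l))) 6) 6

decodes : ∀ {e} → e < 2 → Decodes e (entries e)
decodes {0} _ = from-yes (decodes? 0 (entries 0))
decodes {1} _ = from-yes (decodes? 1 (entries 1))
decodes {suc (suc _)} (s≤s (s≤s ()))

1≤3∸e : ∀ {e} → e < 2 → 1 ≤ 3 ∸ e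
1≤3∸e e<2 = ≤-trans (n≤1+n 1) (∸-monoʳ-≤ 3 (s≤s⁻¹ e<2))

fromOrigin-cap : ∀ Z σ {e} → e < 2 → ∀ U k l →
  fromOrigin Z σ e U k l + k ⊓ 5 ≡ fromOrigin Z σ e U (k ⊓ 5) (l ⊓ 5) + k
fromOrigin-cap Z right {e} e<2 U k l = H-cap Z U 0 e k l z≤n
fromOrigin-cap Z left  {e} e<2 U k l = H-cap U Z 1 (3 ∸ e) k l (1≤3∸e e<2)

fromMiddle-cap : ∀ σ {e} → e < 2 → ∀ U k l →
  fromMiddle σ e U k l + l ⊓ 5 ≡ fromMiddle σ e U (k ⊓ 5) (l ⊓ 5) + l
fromMiddle-cap right {e} e<2 U k l = H-cap U P 0 e l k z≤n
fromMiddle-cap left  {e} e<2 U k l = H-cap P U 1 (3 ∸ e) l k (1≤3∸e e<2)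

k≤fromOrigin : ∀ Z σ e U k l → k ≤ fromOrigin Z σ e U k l
k≤fromOrigin Z right e U k l = k≤H Z U 0 e k l
k≤fromOrigin Z left  e U k l = k≤H U Z 1 (3 ∸ e) k l

l≤fromMiddle : ∀ σ e U k l → l ≤ fromMiddle σ e U k l
l≤fromMiddle right e U k l = k≤H U P 0 e l k
l≤fromMiddle left  e U k l = k≤H P U 1 (3 ∸ e) l k

-- Valid for truncated subtraction too, as both sides equal `(x + u) ∸ (u + v)`.
∸-cross : ∀ x y u v → x + u ≡ y + v → x ∸ v ≡ y ∸ u
∸-cross x y u v eq = begin
  x ∸ v              ≡⟨ [m+n]∸[m+o]≡n∸o u x v ⟨
  u + x ∸ (u + v)    ≡⟨ cong₂ _∸_ (trans (+-comm u x) (trans eq (+-comm y v))) (+-comm u v) ⟩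
  v + y ∸ (v + u)    ≡⟨ [m+n]∸[m+o]≡n∸o v y u ⟩
  y ∸ u              ∎
  where open ≡-Reasoning

⊓5-cap : ∀ {x y k} → x + k ⊓ 5 ≡ y + k → k ≤ x → k ⊓ 5 ≤ y → x ⊓ 5 ≡ y ⊓ 5
⊓5-cap {x} {y} {k} eq k≤x K≤y with k ≤? 5
... | yes k≤5 rewrite m≤n⇒m⊓n≡m k≤5 = cong (_⊓ 5) (+-cancelʳ-≡ k x y eq)
... | no k≰5 rewrite m≥n⇒m⊓n≡n (≰⇒≥ k≰5) =
  trans (m≥n⇒m⊓n≡n (≤-trans (≰⇒≥ k≰5) k≤x)) (sym (m≥n⇒m⊓n≡n K≤y))

half-cap : ∀ σ e k l → half σ e k l + (k ⊓ 5 + l ⊓ 5) ≡ half σ e (k ⊓ 5) (l ⊓ 5) + (k + l)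
half-cap right e k l = +-comm (k + l) (k ⊓ 5 + l ⊓ 5)
half-cap left  e k l = solve 3 (λ x y s → x :+ s :+ y := y :+ s :+ x) refl (k + l) (k ⊓ 5 + l ⊓ 5) (2 ∸ e)

-- Keys are unchanged by capping the coordinates at 5.

module _ {e} (e<2 : e < 2) (σ : Side) (U : Kind) (k l : ℕ) where

  private
    K = k ⊓ 5
    L = l ⊓ 5
    a  = fromOrigin P σ e U k l
    b  = fromMiddle σ e U k l
    c  = fromOrigin R σ e U k l
    a° = fromOrigin P σ e U K L
    b° = fromMiddle σ e U K L
    c° = fromOrigin R σ e U K L
    open ≡-Reasoning

    -- Capping lowers `a + b` and the half length by the same amount, so their difference in the key
    -- is kept.
    sum-cap : (a + b) + half σ e K L ≡ (a° + b°) + half σ e k l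
    sum-cap = +-cancelʳ-≡ (K + L + (k + l)) _ _ (begin
      a + b + half σ e K L + (K + L + (k + l))
        ≡⟨ solve 6 (λ a b h K L s → a :+ b :+ h :+ (K :+ L :+ s) := (a :+ K) :+ (b :+ L) :+ (h :+ s))
             refl a b (half σ e K L) K L (k + l) ⟩
      (a + K) + (b + L) + (half σ e K L + (k + l))
        ≡⟨ cong₂ _+_ (cong₂ _+_ (fromOrigin-cap P σ e<2 U k l) (fromMiddle-cap σ e<2 U k l)) (sym (half-cap σ e k l)) ⟩
      (a° + k) + (b° + l) + (half σ e k l + (K + L))
        ≡⟨ solve 6 (λ a b h k l s → (a :+ k) :+ (b :+ l) :+ (h :+ s) := a :+ b :+ h :+ (s :+ (k :+ l)))
             refl a° b° (half σ e k l) k l (K + L) ⟩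
      a° + b° + half σ e k l + (K + L + (k + l)) ∎)

    -- The distances `a` and `c` to the two landmarks at the origin both drop by the amount cut from
    -- `k`.
    difference-cap : (c + 5) + a° ≡ (c° + 5) + a
    difference-cap = +-cancelʳ-≡ (K + k) _ _ (begin
      c + 5 + a° + (K + k)
        ≡⟨ solve 4 (λ c a K k → c :+ con 5 :+ a :+ (K :+ k) := (c :+ K) :+ (a :+ k) :+ con 5) refl c a° K k ⟩
      (c + K) + (a° + k) + 5
        ≡⟨ cong (_+ 5) (cong₂ _+_ (fromOrigin-cap R σ e<2 U k l) (sym (fromOrigin-cap P σ e<2 U k l))) ⟩
      (c° + k) + (a + K) + 5
        ≡⟨ solve 4 (λ c a K k → (c :+ k) :+ (a :+ K) :+ con 5 := c :+ con 5 :+ a :+ (K :+ k)) refl c° a K k ⟩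
      c° + 5 + a + (K + k) ∎)

  keyAt-cap : keyAt σ e U k l ≡ keyAt σ e U K L
  keyAt-cap = cong₂ _,_ (∸-cross (a + b) (a° + b°) (half σ e K L) (half σ e k l) sum-cap) (cong₂ _,_ (∸-cross (c + 5) (c° + 5) a° a difference-cap) (cong₂ _,_
    (⊓5-cap (fromOrigin-cap P σ e<2 U k l) (k≤fromOrigin P σ e U k l) (k≤fromOrigin P σ e U K L))
    (⊓5-cap (fromMiddle-cap σ e<2 U k l) (l≤fromMiddle σ e U k l) (l≤fromMiddle σ e U K L))))

  infoAt-cap : infoAt σ e U k l ≡ infoAt σ e U K L
  infoAt-cap = cong (λ d → σ , U , d) (∸-cross a a° K k (fromOrigin-cap P σ e<2 U k l))

  half-cap-≥3 : 3 ≤ half σ e k l → 3 ≤ half σ e K L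
  half-cap-≥3 3≤m with k ≤? 5 | l ≤? 5
  ... | yes k≤5 | yes l≤5 rewrite m≤n⇒m⊓n≡m k≤5 | m≤n⇒m⊓n≡m l≤5 = 3≤m
  ... | no k≰5  | _       rewrite m≥n⇒m⊓n≡n (≰⇒≥ k≰5) = ≤-trans (m≤m+n 3 _) (sum≤half σ)
    where
    sum≤half : ∀ σ → 5 + L ≤ half σ e 5 L
    sum≤half right = ≤-refl
    sum≤half left  = m≤m+n (5 + L) _
  ... | _       | no l≰5  rewrite m≥n⇒m⊓n≡n (≰⇒≥ l≰5) = ≤-trans (≤-trans (m≤m+n 3 2) (m≤n+m 5 K)) (sum≤half σ)
    where
    sum≤half : ∀ σ → K + 5 ≤ half σ e K 5
    sum≤half right = ≤-refl
    sum≤half left  = m≤m+n (K + 5) _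

  lookup-keyAt : 3 ≤ half σ e k l → lookupKey (entries e) (keyAt σ e U k l) ≡ just (infoAt σ e U k l)
  lookup-keyAt 3≤m = trans (cong (lookupKey (entries e)) keyAt-cap)
    (trans (decodes e<2 σ U (s≤s (m⊓n≤n k 5)) (s≤s (m⊓n≤n l 5)) (half-cap-≥3 3≤m)) (cong just (sym infoAt-cap)))

-- Equal distances give equal keys, hence the same side, kind and excess. The excess determines `k`,
-- and the half length then determines `l`.
code-injective : ∀ {e} → e < 2 → ∀ σ U k l τ V k' l' →
  3 ≤ half σ e k l → half σ e k l ≡ half τ e k' l' →
  fromOrigin P σ e U k l ≡ fromOrigin P τ e V k' l' →
  fromMiddle σ e U k l ≡ fromMiddle τ e V k' l' →
  fromOrigin R σ e U k l ≡ fromOrigin R τ e V k' l' →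
  σ ≡ τ × U ≡ V × k ≡ k' × l ≡ l'
code-injective {e} e<2 σ U k l τ V k' l' 3≤m m≡ eq₁ eq₂ eq₃
  with Maybe.just-injective (trans (sym (lookup-keyAt e<2 σ U k l 3≤m))
    (trans (cong (lookupKey (entries e)) (cong₂ (λ m (a , b , c) → key m a b c) m≡ (cong₂ _,_ eq₁ (cong₂ _,_ eq₂ eq₃))))
    (lookup-keyAt e<2 τ V k' l' (subst (3 ≤_) m≡ 3≤m))))
... | same with Product.,-injective same
...   | refl , same' with Product.,-injective same'
...     | refl , same″ = refl , refl , k≡k' , l≡l' σ m≡
  where
  k≡k' : k ≡ k'
  k≡k' = ∸-cancelˡ-≡ (k≤fromOrigin P σ e U k l) (subst (k' ≤_) (sym eq₁) (k≤fromOrigin P σ e U k' l'))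
    (trans same″ (cong (_∸ k') (sym eq₁)))
  l≡l' : ∀ σ → half σ e k l ≡ half σ e k' l' → l ≡ l'
  l≡l' right m≡ = +-cancelˡ-≡ k l l' (trans m≡ (cong (_+ l') (sym k≡k')))
  l≡l' left  m≡ = +-cancelˡ-≡ k l l' (trans (+-cancelʳ-≡ (2 ∸ e) _ _ m≡) (cong (_+ l') (sym k≡k')))

-- An independent resolving set of three vertices.

module _ (m e : ℕ) (3≤m : 3 ≤ m) (e<2 : e < 2) .{{_ : NonZero (m + m + e)}} where

  private
    n : ℕ
    n = m + m + e

  spot : Side → Kind → ℕ → ℕ → V n
  spot right U k l = π n U k
  spot left  U k l = π n U (m + (1 + l))

  left-length : ∀ k l → half left e k l ≡ m → (1 + k) + (m + (1 + l)) ≡ n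
  left-length k l refl = go e e<2
    where
    -- The truncated `2 ∸ e` reduces only at numerals, so the ring solver is called for each parity
    -- separately.
    go : ∀ e → e < 2 → let m = k + l + (2 ∸ e) in (1 + k) + (m + (1 + l)) ≡ m + m + e
    go 0 _ = solve 2 (λ k l → con 1 :+ k :+ (k :+ l :+ con 2 :+ (con 1 :+ l))
      := k :+ l :+ con 2 :+ (k :+ l :+ con 2) :+ con 0) refl k l
    go 1 _ = solve 2 (λ k l → con 1 :+ k :+ (k :+ l :+ con 1 :+ (con 1 :+ l))
      := k :+ l :+ con 1 :+ (k :+ l :+ con 1) :+ con 1) refl k l
    go (suc (suc _)) (s≤s (s≤s ()))

  arc₁ : ∀ k l → half right e k l ≡ m → k + (e + (k + (l + l))) ≡ n
  arc₁ k l refl = solve 3 (λ k l e → k :+ (e :+ (k :+ (l :+ l))) := k :+ l :+ (k :+ l) :+ e) refl k l e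

  arc₂ : ∀ k l → half left e k l ≡ m → (1 + k) + (3 ∸ e + (k + (l + l))) ≡ n
  arc₂ k l refl = go e e<2
    where
    go : ∀ e → e < 2 → let m = k + l + (2 ∸ e) in (1 + k) + (3 ∸ e + (k + (l + l))) ≡ m + m + e
    go 0 _ = solve 2 (λ k l → con 1 :+ k :+ (con 3 :+ (k :+ (l :+ l)))
      := k :+ l :+ con 2 :+ (k :+ l :+ con 2) :+ con 0) refl k l
    go 1 _ = solve 2 (λ k l → con 1 :+ k :+ (con 2 :+ (k :+ (l :+ l)))
      := k :+ l :+ con 1 :+ (k :+ l :+ con 1) :+ con 1) refl k l
    go (suc (suc _)) (s≤s (s≤s ()))

  locate-spot : ∀ v → ∃ λ σ → ∃ λ U → ∃ λ k → ∃ λ l → half σ e k l ≡ m × v ≡ spot σ U k l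
  locate-spot v with offset n 0 (index n v)
  ... | t , b , eq , t≡ with t ≤? m
  ...   | yes t≤m = right , kind n v , t , m ∸ t , m+[n∸m]≡n t≤m ,
    trans (sym (at-kind-index n v)) (cong (at n (kind n v)) t≡)
  ...   | no t≰m = left , kind n v , b , t ∸ suc m , middle e e<2 (+-cancelˡ-≡ m _ _ total) ,
    trans (sym (at-kind-index n v)) (cong (at n (kind n v)) (trans t≡ (cong (pos n) (sym t-split))))
    where
    l = t ∸ suc m
    t-split : m + (1 + l) ≡ t
    t-split = trans (+-suc m l) (m+[n∸m]≡n (≰⇒> t≰m))
    total : m + (1 + l + suc b) ≡ m + (m + e)
    total = trans (sym (+-assoc m (1 + l) (suc b))) (trans (cong (_+ suc b) t-split) (trans eq (+-assoc m m e)))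
    middle : ∀ e → e < 2 → 1 + l + suc b ≡ m + e → b + l + (2 ∸ e) ≡ m
    middle 0 _ h = trans (solve 2 (λ b l → b :+ l :+ con 2 := con 1 :+ l :+ (con 1 :+ b)) refl b l)
      (trans h (+-identityʳ m))
    middle 1 _ h = suc-injective (trans
      (solve 2 (λ b l → con 1 :+ (b :+ l :+ con 1) := con 1 :+ l :+ (con 1 :+ b)) refl b l) (trans h (+-comm m 1)))
    middle (suc (suc _)) (s≤s (s≤s ()))

  half-comm : ∀ σ k l → half σ e k l ≡ m → half σ e l k ≡ m
  half-comm right k l = trans (+-comm l k)
  half-comm left  k l = trans (cong (_+ (2 ∸ e)) (+-comm l k))

  Dist-origin : ∀ Z σ U k l → half σ e k l ≡ m → Dist n (π n Z 0) (spot σ U k l) (fromOrigin Z σ e U k l)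
  Dist-origin Z right U k l m≡ = Dist-π n Z U 0 k _ (arc₁ k l m≡)
  Dist-origin Z left  U k l m≡ = Dist-sym n (subst (λ t → Dist n (spot left U k l) (at n Z t) (H U Z 1 (3 ∸ e) k l))
    (trans (cong (pos n) (trans (+-comm (m + (1 + l)) (1 + k)) (left-length k l m≡))) (pos-+n n 0))
    (Dist-π n U Z (m + (1 + l)) (1 + k) _ (arc₂ k l m≡)))

  Dist-middle : ∀ σ U k l → half σ e k l ≡ m → Dist n (π n P m) (spot σ U k l) (fromMiddle σ e U k l)
  Dist-middle right U k l m≡ = Dist-sym n (subst (λ t → Dist n (π n U k) (π n P t) (H U P 0 e l k)) m≡
    (Dist-π n U P k l _ (arc₁ l k (half-comm right k l m≡))))
  Dist-middle left  U k l m≡ = Dist-π n P U m (1 + l) _ (arc₂ l k (half-comm left k l m≡))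

  landmarks : List (V n)
  landmarks = π n P 0 ∷ π n P m ∷ π n R 0 ∷ []

  resolving : Resolving n landmarks
  resolving u v u≢v with locate-spot u | locate-spot v
  ... | σ , U , k , l , m≡ , refl | τ , V , k' , l' , m≡' , refl
    with fromOrigin P σ e U k l ≟ fromOrigin P τ e V k' l'
       | fromMiddle σ e U k l ≟ fromMiddle τ e V k' l'
       | fromOrigin R σ e U k l ≟ fromOrigin R τ e V k' l'
  ... | no ≢₁ | _ | _ = _ , here refl , _ , _ ,
    Dist-origin P σ U k l m≡ , Dist-origin P τ V k' l' m≡' , ≢₁
  ... | yes _ | no ≢₂ | _ = _ , there (here refl) , _ , _ ,
    Dist-middle σ U k l m≡ , Dist-middle τ V k' l' m≡' , ≢₂
  ... | yes _ | yes _ | no ≢₃ = _ , there (there (here refl)) , _ , _ ,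
    Dist-origin R σ U k l m≡ , Dist-origin R τ V k' l' m≡' , ≢₃
  ... | yes eq₁ | yes eq₂ | yes eq₃
    with refl , refl , refl , refl ← code-injective e<2 σ U k l τ V k' l'
           (subst (3 ≤_) (sym m≡) 3≤m) (trans m≡ (sym m≡')) eq₁ eq₂ eq₃ = contradiction refl u≢v

  m<n : m < n
  m<n = ≤-trans (m<m+n m (≤-trans (s≤s z≤n) 3≤m)) (m≤m+n (m + m) e)

  1+m<n : suc m < n
  1+m<n = ≤-trans (≤-trans (≤-reflexive (+-comm 2 m)) (+-monoʳ-≤ m (≤-trans (n≤1+n 2) 3≤m))) (m≤m+n (m + m) e)

  0<n : 0 < n
  0<n = ≤-trans (s≤s z≤n) m<n

  0≢m : 0 ≢ m
  0≢m = <⇒≢ (≤-trans (s≤s z≤n) 3≤m)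

  unique : Unique landmarks
  unique = ((λ eq → 0≢m (pos-injective n 0 0<n m<n (proj₂ (π-injective n 0 m eq)))) ∷ (λ ()) ∷ []) ∷
    ((λ ()) ∷ []) ∷ [] ∷ []

  -- An edge within kind `P` raises the index by 1 modulo `n`, and neither `1` nor `m + 1` is `0` or
  -- `m` modulo `n`. No edge joins kinds `P` and `R`, or two vertices of kind `R`.
  independent : Independent n landmarks
  independent u v u∈ v∈ (inj₁ edge) = no-edge u∈ v∈ edge
    where
    p-edge : ∀ {a b} → suc a < n → b < n → suc a ≢ b → ¬ Edge n (π n P a) (π n P b)
    p-edge a<n b<n ≢b edge = ≢b (pos-injective n 0 a<n b<n (trans (sym (nxt-pos n _)) (sym (target edge))))
      where
      target : ∀ {s t} → Edge n (p s) (p t) → t ≡ nxt n s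
      target (pp _) = refl
    1<n : 1 < n
    1<n = ≤-trans (≤-trans (n≤1+n 2) 3≤m) (<⇒≤ m<n)
    no-edge : ∀ {u v} → u ∈ landmarks → v ∈ landmarks → ¬ Edge n u v
    no-edge (here refl)         (here refl)         edge = p-edge 1<n 0<n (λ ()) edge
    no-edge (here refl)         (there (here refl)) edge = p-edge 1<n m<n (<⇒≢ (≤-trans (n≤1+n 2) 3≤m)) edge
    no-edge (there (here refl)) (here refl)         edge = p-edge 1+m<n 0<n (λ ()) edge
    no-edge (there (here refl)) (there (here refl)) edge = p-edge 1+m<n m<n 1+n≢n edge
    no-edge (here refl)                 (there (there (here refl))) ()
    no-edge (there (here refl))         (there (there (here refl))) ()
    no-edge (there (there (here refl))) (here refl)                 ()
    no-edge (there (there (here refl))) (there (here refl))         ()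
    no-edge (there (there (here refl))) (there (there (here refl))) ()
  independent u v u∈ v∈ (inj₂ edge) = independent v u v∈ u∈ (inj₁ edge)

-- The independent location number.

location≤3 : ∀ n m e → m + m + e ≡ n → 3 ≤ m → e < 2 → .{{_ : NonZero n}} →
  Σ (List (V n)) λ Y → Unique Y × Independent n Y × Resolving n Y × length Y ≡ 3
location≤3 _ m e refl 3≤m e<2 =
  landmarks m e 3≤m e<2 , unique m e 3≤m e<2 , independent m e 3≤m e<2 , resolving m e 3≤m e<2 , refl

theorem6 : (n : ℕ) .{{nz : NonZero n}} → 6 ≤ n →
    (Σ (List (V n)) λ Y → Unique Y × Independent n Y × Resolving n Y × length Y ≡ 3)
    × ((Y : List (V n)) → Unique Y → Independent n Y → Resolving n Y → 3 ≤ length Y)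
theorem6 n 6≤n =
  location≤3 n (n / 2) (n % 2) halves (/-monoˡ-≤ 2 6≤n) (m%n<n n 2) ,
  λ Y _ _ → resolving⇒3≤length n 6≤n Y
  where
  halves : n / 2 + n / 2 + n % 2 ≡ n
  halves = trans (solve 2 (λ m e → m :+ m :+ e := e :+ m :* con 2) refl (n / 2) (n % 2))
    (sym (m≡m%n+[m/n]*n n 2))
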